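{- For every $i\ge1$, the word $b_4$ avoids $T_i$.
   Context: A formula is a finite set of non-empty words over variables (fragments), written separated by dots. An occurrence of a formula $f$ in a word $w$ is a non-erasing morphism $h$ from variables to non-empty words such that $h(\phi)$ is a factor of $w$ for every fragment $\phi$; $w$ avoids $f$ if it has no occurrence. For $i\ge1$, $T_i$ is the formula on variables $A_0,\dots,A_{i-1}$ whose fragments are the $i$ words $A_jA_{j+1}A_j$, $0\le j\le i-1$, indices modulo $i$. $b_4$ is the fixed point starting with $0$ of the morphism $0\mapsto 01,\ 1\mapsto 03,\ 2\mapsto 21,\ 3\mapsto 23$. -}

module Defs where

open import Data.Nat using (ℕ; zero; suc; _<_; _^_)
open import Data.Nat.Properties using (_<?_)
open import Data.Fin using (Fin; zero; suc; toℕ; fromℕ<)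
open import Data.List using (List; []; _∷_; concatMap; allFin) renaming (map to lmap)
open import Data.List.NonEmpty using (List⁺; _∷_; toList)
open import Data.List.Membership.Propositional using (_∈_)
open import Data.Product using (Σ; _×_)
open import Data.Unit using (⊤)
open import Relation.Binary.PropositionalEquality using (_≡_)
open import Relation.Nullary using (¬_; yes; no)

Letter : Set
Letter = Fin 4

Word∞ : Set → Set
Word∞ A = ℕ → A

σ : Letter → List Letter
σ zero                   = zero ∷ suc zero ∷ []
σ (suc zero)             = zero ∷ suc (suc (suc zero)) ∷ []
σ (suc (suc zero))       = suc (suc zero) ∷ suc zero ∷ []
σ (suc (suc (suc zero))) = suc (suc zero) ∷ suc (suc (suc zero)) ∷ []

σ* : List Letter → List Letter
σ* = concatMap σ

σIter : ℕ → List Letter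
σIter zero    = zero ∷ []
σIter (suc k) = σ* (σIter k)

-- n-th letter of a list (default 0 if out of range; never used below)
nth : List Letter → ℕ → Letter
nth []       _       = zero
nth (x ∷ xs) zero    = x
nth (x ∷ xs) (suc n) = nth xs n

-- b4 = lim σ^k(0), the fixed point of σ starting with 0.
-- σ^(n+1)(0) has length 2^(n+1) > n and is a prefix of b4.
b4 : Word∞ Letter
b4 n = nth (σIter (suc n)) n

OccursAt : {A : Set} → List A → Word∞ A → ℕ → Set
OccursAt []       w p = ⊤
OccursAt (a ∷ u)  w p = (w p ≡ a) × OccursAt u w (suc p)

Factor : {A : Set} → List A → Word∞ A → Set
Factor u w = Σ ℕ (λ p → OccursAt u w p)

-- A formula over variables V: a finite set (list) of non-empty fragments
Formula : Set → Set
Formula V = List (List⁺ V)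

image : {V A : Set} → (V → List⁺ A) → List⁺ V → List A
image h φ = concatMap (λ x → toList (h x)) (toList φ)

IsOccurrence : {V A : Set} → Word∞ A → Formula V → (V → List⁺ A) → Set
IsOccurrence w f h = ∀ φ → φ ∈ f → Factor (image h φ) w

Avoids : {V A : Set} → Word∞ A → Formula V → Set
Avoids {V} {A} w f = ¬ (Σ (V → List⁺ A) (λ h → IsOccurrence w f h))

cnext : {n : ℕ} → Fin (suc n) → Fin (suc n)
cnext {n} j with suc (toℕ j) <? suc n
... | yes p = fromℕ< p
... | no _  = zero

T : (i : ℕ) → Formula (Fin i)
T zero    = []
T (suc n) = lmap (λ j → j ∷ (cnext j ∷ j ∷ [])) (allFin (suc n))

{-# OPTIONS --safe #-}

-- Write h_j for the image of A_j, l_j for its length, p_j for a position of h_j h_{j+1} h_j in b4,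
-- and d_j = l_j + l_{j+1} for the distance between the two copies of h_j there.
--
-- b4(m) records the parity of m together with a paperfolding bit, and that bit at m = 2^c (2u+1)
-- is the parity of u.  Hence if equal windows sit at p ≡ q (mod 2^(c+1)) and contain a position
-- ≡ 2^c (mod 2^(c+1)), then even p ≡ q (mod 2^(c+2)); in particular, windows of length ≥ 2^a
-- force p ≡ q (mod 2^(a+1)).
--
-- It follows that 2^a ∣ d_j for all j, by induction on a, which is absurd as d_j > 0.  For the step
-- from M = 2^a to 2M, suppose 2M ∤ d_j; then x = l_j < M.  Along k = j+1, j+3, j+5, … one keeps
-- 2M ∤ x + l_k while 2M ∣ d_k, so that l_{k+1} ≡ x (mod M) differs from x and is therefore ≥ M.
-- Since the indices are cyclic, this eventually says l_j ≥ M.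
module Submission where

open import Defs
open import Data.Empty using (⊥; ⊥-elim)
open import Data.Fin using (Fin; zero; suc; toℕ)
open import Data.Fin.Properties using (toℕ-injective; toℕ-fromℕ<; toℕ<n)
open import Data.List using (List; []; _∷_; _++_; length)
open import Data.List.Membership.Propositional.Properties using (∈-map⁺; ∈-allFin)
open import Data.List.NonEmpty using (_∷_; toList)
open import Data.List.Properties using (++-identityʳ)
open import Data.Nat using (ℕ; zero; suc; _+_; _*_; _^_; _≤_; _<_; z≤n; s≤s; NonZero; >-nonZero; _/_; _%_)
open import Data.Nat.DivMod using ([m+kn]%n≡m%n; m<n⇒m%n≡m; m≡m%n+[m/n]*n; m%n<n; n%n≡0; m%n%n≡m%n)
open import Data.Nat.Divisibility using (_∣_; _∣?_; divides; 1∣_; ∣⇒≤; n∣m*n; ∣m+n∣m⇒∣n; ∣m∣n⇒∣m+n)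
open import Data.Nat.Properties
open import Data.Nat.Tactic.RingSolver using (solve-∀)
open import Data.Product using (_×_; _,_; ∃; ∃₂; proj₁; proj₂)
open import Data.Sum using (_⊎_; inj₁; inj₂)
open import Data.Unit using (⊤; tt)
open import Function using (_∘_)
open import Relation.Binary.PropositionalEquality
open import Relation.Nullary using (¬_; yes; no)

-- Congruences

infix 4 _≡_[mod_]

_≡_[mod_] : ℕ → ℕ → ℕ → Set
m ≡ n [mod M ] = ∃₂ λ r s → m + r * M ≡ n + s * M

mod-reflexive : ∀ {M m n} → m ≡ n → m ≡ n [mod M ]
mod-reflexive m≡n = 0 , 0 , cong (_+ 0) m≡n

mod-sym : ∀ {M m n} → m ≡ n [mod M ] → n ≡ m [mod M ]
mod-sym (r , s , eq) = s , r , sym eq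

mod-trans : ∀ {M m n o} → m ≡ n [mod M ] → n ≡ o [mod M ] → m ≡ o [mod M ]
mod-trans {M} {m} {n} {o} (r , s , eq) (r′ , s′ , eq′) = r + r′ , s + s′ , (begin
  m + (r + r′) * M       ≡⟨ regroup m r r′ M ⟩
  (m + r * M) + r′ * M   ≡⟨ cong (_+ r′ * M) eq ⟩
  (n + s * M) + r′ * M   ≡⟨ exchange n s r′ M ⟩
  (n + r′ * M) + s * M   ≡⟨ cong (_+ s * M) eq′ ⟩
  (o + s′ * M) + s * M   ≡⟨ exchange o s′ s M ⟩
  (o + s * M) + s′ * M   ≡⟨ regroup o s s′ M ⟨
  o + (s + s′) * M       ∎)
  where
  open ≡-Reasoning
  regroup : ∀ m r r′ M → m + (r + r′) * M ≡ (m + r * M) + r′ * M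
  regroup = solve-∀
  exchange : ∀ n s r M → (n + s * M) + r * M ≡ (n + r * M) + s * M
  exchange = solve-∀

mod-+ʳ : ∀ {M m n} o → m ≡ n [mod M ] → m + o ≡ n + o [mod M ]
mod-+ʳ {M} {m} {n} o (r , s , eq) =
  r , s , trans (swap m o (r * M)) (trans (cong (_+ o) eq) (sym (swap n o (s * M))))
  where
  swap : ∀ a b c → a + b + c ≡ a + c + b
  swap = solve-∀

mod-cancelˡ : ∀ {M m n} o → o + m ≡ o + n [mod M ] → m ≡ n [mod M ]
mod-cancelˡ {M} {m} {n} o (r , s , eq) = r , s ,
  +-cancelˡ-≡ o _ _ (trans (sym (+-assoc o m (r * M))) (trans eq (+-assoc o n (s * M))))

mod-cancelʳ : ∀ {M m n} o → m + o ≡ n + o [mod M ] → m ≡ n [mod M ]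
mod-cancelʳ {M} {m} {n} o c = mod-cancelˡ o (subst₂ (_≡_[mod M ]) (+-comm m o) (+-comm n o) c)

mod⇒%≡ : ∀ {M m n} .{{_ : NonZero M}} → m ≡ n [mod M ] → m % M ≡ n % M
mod⇒%≡ {M} {m} {n} (r , s , eq) =
  trans (sym ([m+kn]%n≡m%n m r M)) (trans (cong (_% M) eq) ([m+kn]%n≡m%n n s M))

%≡⇒mod : ∀ {M m n} .{{_ : NonZero M}} → m % M ≡ n % M → m ≡ n [mod M ]
%≡⇒mod {M} {m} {n} eq = n / M , m / M , (begin
  m + n / M * M                       ≡⟨ cong (_+ n / M * M) (m≡m%n+[m/n]*n m M) ⟩
  m % M + m / M * M + n / M * M       ≡⟨ cong (λ x → x + m / M * M + n / M * M) eq ⟩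
  n % M + m / M * M + n / M * M       ≡⟨ swap (n % M) (m / M * M) (n / M * M) ⟩
  n % M + n / M * M + m / M * M       ≡⟨ cong (_+ m / M * M) (m≡m%n+[m/n]*n n M) ⟨
  n + m / M * M                       ∎)
  where
  open ≡-Reasoning
  swap : ∀ a b c → a + b + c ≡ a + c + b
  swap = solve-∀

mod-<⇒≡ : ∀ {M m n} .{{_ : NonZero M}} → m < M → n < M → m ≡ n [mod M ] → m ≡ n
mod-<⇒≡ m<M n<M c = trans (sym (m<n⇒m%n≡m m<M)) (trans (mod⇒%≡ c) (m<n⇒m%n≡m n<M))

mod⇒∣ : ∀ {M} p d → p ≡ p + d [mod M ] → M ∣ d
mod⇒∣ {M} p d (r , s , eq) = ∣m+n∣m⇒∣n (divides r sM+d≡rM) (n∣m*n s)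
  where
  sM+d≡rM : s * M + d ≡ r * M
  sM+d≡rM = trans (+-comm (s * M) d)
    (+-cancelˡ-≡ p _ _ (trans (sym (+-assoc p d (s * M))) (sym eq)))

∣⇒mod : ∀ {M d} p → M ∣ d → p ≡ p + d [mod M ]
∣⇒mod p (divides q refl) = q , 0 , sym (+-identityʳ _)

∣+⇒≡ : ∀ {M x x′} y .{{_ : NonZero M}} → x < M → x′ < M → M ∣ y + x → M ∣ y + x′ → x ≡ x′
∣+⇒≡ {M} {x} {x′} y x<M x′<M (divides q eq) (divides q′ eq′) = mod-<⇒≡ x<M x′<M
  (mod-cancelˡ y (q′ , q , trans (cong₂ _+_ eq (sym eq′)) (+-comm (q * M) (y + x′))))

-- `y + u` is `(u + v) + (y + w)` minus `v + w`. In the loop this trades `l k` for `l (2 + k)`, or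
-- back, in a sum with `l j`.
∣-exchange : ∀ {M y u v w} → M ∣ u + v → M ∣ v + w → M ∣ y + w → M ∣ y + u
∣-exchange {M} {y} {u} {v} {w} M∣u+v M∣v+w M∣y+w =
  ∣m+n∣m⇒∣n (subst (M ∣_) (regroup y u v w) (∣m∣n⇒∣m+n M∣u+v M∣y+w)) M∣v+w
  where
  regroup : ∀ y u v w → (u + v) + (y + w) ≡ (v + w) + (y + u)
  regroup = solve-∀

reach : ∀ M .{{_ : NonZero M}} p r → ∃ λ t → t < M × p + t ≡ r [mod M ]
reach (suc M) p r = s % suc M , m%n<n s (suc M) , s / suc M , p , (begin
  p + s % suc M + s / suc M * suc M     ≡⟨ +-assoc p _ _ ⟩
  p + (s % suc M + s / suc M * suc M)   ≡⟨ cong (p +_) (m≡m%n+[m/n]*n s (suc M)) ⟨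
  p + (r + p * M)                       ≡⟨ regroup p r M ⟩
  r + p * suc M                         ∎)
  where
  open ≡-Reasoning
  -- This stands for r - p, since `p + p * M` is a multiple of the modulus `suc M`.
  s = r + p * M
  regroup : ∀ p r M → p + (r + p * M) ≡ r + p * (1 + M)
  regroup = solve-∀

n<2^n : ∀ n → n < 2 ^ n
n<2^n zero    = s≤s z≤n
n<2^n (suc n) = ≤-trans (s≤s (n<2^n n))
  (subst (suc (2 ^ n) ≤_) (cong (2 ^ n +_) (sym (+-identityʳ (2 ^ n)))) (+-monoˡ-≤ (2 ^ n) (m^n>0 2 n)))

-- The letters of b4

-- The binary digits of a letter. `σ` sends the letter with (high, low) bits (h, e) to the letters
-- with bits (h, 0) and (e, 1).
lowBit highBit : Letter → ℕ
lowBit zero                   = 0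
lowBit (suc zero)             = 1
lowBit (suc (suc zero))       = 0
lowBit (suc (suc (suc zero))) = 1
highBit zero                   = 0
highBit (suc zero)             = 0
highBit (suc (suc zero))       = 1
highBit (suc (suc (suc zero))) = 1

length-σ* : ∀ w → length (σ* w) ≡ length w * 2
length-σ* []                             = refl
length-σ* (zero ∷ w)                     = cong (2 +_) (length-σ* w)
length-σ* (suc zero ∷ w)                 = cong (2 +_) (length-σ* w)
length-σ* (suc (suc zero) ∷ w)           = cong (2 +_) (length-σ* w)
length-σ* (suc (suc (suc zero)) ∷ w)     = cong (2 +_) (length-σ* w)

length-σIter : ∀ k → length (σIter k) ≡ 2 ^ k
length-σIter zero    = refl
length-σIter (suc k) =
  trans (length-σ* (σIter k)) (trans (cong (_* 2) (length-σIter k)) (*-comm (2 ^ k) 2))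

-- No bound on n is needed: past the end of w both sides read the default letter 0.
σ*-even : ∀ w n → lowBit (nth (σ* w) (n * 2)) ≡ 0 × highBit (nth (σ* w) (n * 2)) ≡ highBit (nth w n)
σ*-even []                               n       = refl , refl
σ*-even (zero ∷ w)                       zero    = refl , refl
σ*-even (suc zero ∷ w)                   zero    = refl , refl
σ*-even (suc (suc zero) ∷ w)             zero    = refl , refl
σ*-even (suc (suc (suc zero)) ∷ w)       zero    = refl , refl
σ*-even (zero ∷ w)                       (suc n) = σ*-even w n
σ*-even (suc zero ∷ w)                   (suc n) = σ*-even w n
σ*-even (suc (suc zero) ∷ w)             (suc n) = σ*-even w n
σ*-even (suc (suc (suc zero)) ∷ w)       (suc n) = σ*-even w n

-- The bound matters here: the default letter 0 read past the end has low bit 0, not 1.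
σ*-odd : ∀ w n → n < length w →
  lowBit (nth (σ* w) (suc (n * 2))) ≡ 1 × highBit (nth (σ* w) (suc (n * 2))) ≡ lowBit (nth w n)
σ*-odd (zero ∷ w)                       zero    _         = refl , refl
σ*-odd (suc zero ∷ w)                   zero    _         = refl , refl
σ*-odd (suc (suc zero) ∷ w)             zero    _         = refl , refl
σ*-odd (suc (suc (suc zero)) ∷ w)       zero    _         = refl , refl
σ*-odd (zero ∷ w)                       (suc n) (s≤s n<w) = σ*-odd w n n<w
σ*-odd (suc zero ∷ w)                   (suc n) (s≤s n<w) = σ*-odd w n n<w
σ*-odd (suc (suc zero) ∷ w)             (suc n) (s≤s n<w) = σ*-odd w n n<w
σ*-odd (suc (suc (suc zero)) ∷ w)       (suc n) (s≤s n<w) = σ*-odd w n n<w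

parity-split : ∀ n → ∃ λ q → (n ≡ q * 2 × n % 2 ≡ 0) ⊎ (n ≡ suc (q * 2) × n % 2 ≡ 1)
parity-split n with n % 2 | m%n<n n 2 | m≡m%n+[m/n]*n n 2
... | 0 | _ | n≡ = n / 2 , inj₁ (n≡ , refl)
... | 1 | _ | n≡ = n / 2 , inj₂ (n≡ , refl)
... | suc (suc _) | s≤s (s≤s ()) | _

halve-< : ∀ k n → n * 2 < 2 ^ suc k → n < 2 ^ k
halve-< k n lt = *-cancelʳ-< 2 n (2 ^ k) (subst (n * 2 <_) (*-comm 2 (2 ^ k)) lt)

lowBit-σIter : ∀ k n → n < 2 ^ k → lowBit (nth (σIter k) n) ≡ n % 2
lowBit-σIter zero    zero    _ = refl
lowBit-σIter zero    (suc n) (s≤s ())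
lowBit-σIter (suc k) n       n<2^ with parity-split n
... | q , inj₁ (refl , even) = trans (proj₁ (σ*-even (σIter k) q)) (sym even)
... | q , inj₂ (refl , odd)  = trans (proj₁ (σ*-odd (σIter k) q q<)) (sym odd)
  where
  q< = subst (q <_) (sym (length-σIter k)) (halve-< k q (<-trans (n<1+n _) n<2^))

-- Each level of `σ*` halves an even position and keeps its high bit. After c halvings the odd
-- position 1 + 2u remains; its high bit is the low bit, hence the parity, of position u.
highBit-σIter : ∀ k c u → (1 + u * 2) * 2 ^ c < 2 ^ k → highBit (nth (σIter k) ((1 + u * 2) * 2 ^ c)) ≡ u % 2
highBit-σIter zero    c       u lt = ⊥-elim (<⇒≱ lt (*-mono-≤ (s≤s (z≤n {u * 2})) (m^n>0 2 c)))
highBit-σIter (suc k) zero    u lt = subst (λ m → highBit (nth (σIter (suc k)) m) ≡ u % 2)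
  (sym (*-identityʳ (1 + u * 2)))
  (trans (proj₂ (σ*-odd (σIter k) u (subst (u <_) (sym (length-σIter k)) u<))) (lowBit-σIter k u u<))
  where
  u< = halve-< k u (<-trans (n<1+n _) (subst (_< 2 ^ suc k) (*-identityʳ (1 + u * 2)) lt))
highBit-σIter (suc k) (suc c) u lt = subst (λ m → highBit (nth (σIter (suc k)) m) ≡ u % 2) (sym double)
  (trans (proj₂ (σ*-even (σIter k) m)) (highBit-σIter k c u (halve-< k m (subst (_< 2 ^ suc k) double lt))))
  where
  m = (1 + u * 2) * 2 ^ c
  regroup : ∀ x y → x * (2 * y) ≡ x * y * 2
  regroup = solve-∀
  double : (1 + u * 2) * 2 ^ suc c ≡ m * 2
  double = regroup (1 + u * 2) (2 ^ c)

n<2^1+n : ∀ n → n < 2 ^ suc n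
n<2^1+n n = <-trans (n<1+n n) (n<2^n (suc n))

lowBit-b4 : ∀ n → lowBit (b4 n) ≡ n % 2
lowBit-b4 n = lowBit-σIter (suc n) n (n<2^1+n n)

highBit-b4 : ∀ c u → highBit (b4 ((1 + u * 2) * 2 ^ c)) ≡ u % 2
highBit-b4 c u = highBit-σIter (suc m) c u (n<2^1+n m)
  where m = (1 + u * 2) * 2 ^ c

b4-parity : ∀ m n → b4 m ≡ b4 n → m ≡ n [mod 2 ]
b4-parity m n eq = %≡⇒mod (trans (sym (lowBit-b4 m)) (trans (cong lowBit eq) (lowBit-b4 n)))

odd-multiple : ∀ c m → m ≡ 2 ^ c [mod 2 ^ suc c ] → ∃ λ u → m ≡ (1 + u * 2) * 2 ^ c
odd-multiple c m m≡ = u , (begin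
  m                                     ≡⟨ m≡m%n+[m/n]*n m (2 ^ suc c) ⟩
  m % 2 ^ suc c + u * 2 ^ suc c         ≡⟨ cong (_+ u * 2 ^ suc c) (trans (mod⇒%≡ m≡) (m<n⇒m%n≡m 2^c<)) ⟩
  2 ^ c + u * (2 * 2 ^ c)               ≡⟨ regroup (2 ^ c) u ⟩
  (1 + u * 2) * 2 ^ c                   ∎)
  where
  open ≡-Reasoning
  instance
    2^≢0 : NonZero (2 ^ suc c)
    2^≢0 = m^n≢0 2 (suc c)
  u = m / 2 ^ suc c
  2^c< : 2 ^ c < 2 ^ suc c
  2^c< = ^-monoʳ-< 2 (s≤s (s≤s z≤n)) (n<1+n c)
  regroup : ∀ x u → x + u * (2 * x) ≡ (1 + u * 2) * x
  regroup = solve-∀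

-- With m = (1 + 2u) 2^c and n = (1 + 2v) 2^c, the high bits give u ≡ v (mod 2), and m - n = 2^(c+1)
-- (u - v).
b4-refine : ∀ c m n → m ≡ 2 ^ c [mod 2 ^ suc c ] → n ≡ 2 ^ c [mod 2 ^ suc c ] →
  b4 m ≡ b4 n → m ≡ n [mod 2 ^ suc (suc c) ]
b4-refine c m n m≡ n≡ eq with odd-multiple c m m≡ | odd-multiple c n n≡
... | u , refl | v , refl with %≡⇒mod {2} {u} {v} (trans (sym (highBit-b4 c u)) (trans (cong highBit eq) (highBit-b4 c v)))
... | r , s , u+2r≡v+2s = r , s ,
  trans (regroup u r (2 ^ c)) (trans (cong (λ x → (1 + x * 2) * 2 ^ c) u+2r≡v+2s) (sym (regroup v s (2 ^ c))))
  where
  regroup : ∀ u r x → (1 + u * 2) * x + r * (2 * (2 * x)) ≡ (1 + (u + r * 2) * 2) * x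
  regroup = solve-∀

-- Equal windows

SameWindow : ℕ → ℕ → ℕ → Set
SameWindow p q n = ∀ t → t < n → b4 (p + t) ≡ b4 (q + t)

window-refine : ∀ c {p q n} → SameWindow p q n → p ≡ q [mod 2 ^ suc c ] →
  ∀ t → t < n → p + t ≡ 2 ^ c [mod 2 ^ suc c ] → p ≡ q [mod 2 ^ suc (suc c) ]
window-refine c {p} {q} same p≡q t t<n p+t≡ = mod-cancelʳ t
  (b4-refine c (p + t) (q + t) p+t≡ (mod-trans (mod-sym (mod-+ʳ t p≡q)) p+t≡) (same t t<n))

-- Induction on a: one letter shows the parity, and a window of length 2^(c+1) runs through all
-- residues mod 2^(c+1), so it meets 2^c and the congruence can be refined.
window-mod : ∀ a {p q n} → 2 ^ a ≤ n → SameWindow p q n → p ≡ q [mod 2 ^ suc a ]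
window-mod zero    {p} {q} 1≤n  same = mod-cancelʳ 0 (b4-parity (p + 0) (q + 0) (same 0 1≤n))
window-mod (suc c) {p}     2^≤n same with reach (2 ^ suc c) {{m^n≢0 2 (suc c)}} p (2 ^ c)
... | t , t<2^ , p+t≡ =
  window-refine c same (window-mod c (≤-trans (m≤m+n _ _) 2^≤n) same) t (<-≤-trans t<2^ 2^≤n) p+t≡

-- The cyclic argument

-- The cyclic indices are unrolled to ℕ, for N = `suc N-1` variables. The even period 2N lets steps
-- of two return to j whatever the parity of N. `repeat` compares the two copies of h_j in one
-- fragment; `meet` compares the start of fragment j+1 with the middle of fragment j.
module Cyclic
  (l p : ℕ → ℕ) (N-1 : ℕ)
  (l>0     : ∀ j → 0 < l j)
  (period  : ∀ j → l (suc N-1 * 2 + j) ≡ l j)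
  (repeat  : ∀ j → SameWindow (p j) (p j + (l j + l (suc j))) (l j))
  (meet    : ∀ j → SameWindow (p (suc j)) (p j + l j) (l (suc j)))
  where

  d : ℕ → ℕ
  d j = l j + l (suc j)

  module Step (c : ℕ) (M∣d : ∀ j → 2 ^ suc c ∣ d j) where

    -- `M` is the divisor already known and `D` = 2M the one sought. A window that meets the residue
    -- `H` = M/2 mod M lifts a congruence mod M to one mod D.
    H M D : ℕ
    H = 2 ^ c
    M = 2 ^ suc c
    D = 2 ^ suc (suc c)

    instance
      M≢0 : NonZero M
      M≢0 = m^n≢0 2 (suc c)

    long⇒D∣d : ∀ k → M ≤ l k → D ∣ d k
    long⇒D∣d k M≤l = mod⇒∣ (p k) (d k) (window-mod (suc c) M≤l (repeat k))

    M≤sum : ∀ x k → M ∣ x + l k → M ≤ x + l k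
    M≤sum x k M∣ = ∣⇒≤ {{>-nonZero (<-≤-trans (l>0 k) (m≤n+m (l k) x))}} M∣

    -- `Q` is what yields D ∣ d_k along k = j+1, j+3, ...: a congruence for `p k` when l_j ≤ H, and
    -- trivial when H < l_j < M.
    module Loop
      (j : ℕ) (short : l j < M) (D∤d : ¬ D ∣ d j) (Q : ℕ → Set) (Q-start : Q (suc j))
      (Q⇒D∣d : ∀ k → Q k → M ∣ l j + l k → D ∣ d k)
      (Q-next : ∀ k → Q k → M ∣ l j + l k → M ≤ l (suc k) → M ∣ l j + l (2 + k) → Q (2 + k))
      where

      index : ℕ → ℕ
      index m = suc (m * 2 + j)

      Invariant : ℕ → Set
      Invariant k = Q k × M ∣ l j + l k × ¬ D ∣ l j + l k

      -- If l_{k+1} < M, then l_j and l_{k+1} are both below M and both complement l_k mod M. They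
      -- are then equal, so l_j + l_k is d_k, which D divides.
      next-long : ∀ k → Invariant k → M ≤ l (suc k)
      next-long k (Qk , M∣ , D∤) with <-≤-connex (l (suc k)) M
      ... | inj₂ M≤l = M≤l
      ... | inj₁ l<M = ⊥-elim (D∤ (subst (D ∣_) (trans (cong (l k +_) (sym l≡)) (+-comm (l k) (l j))) (Q⇒D∣d k Qk M∣)))
        where
        l≡ : l j ≡ l (suc k)
        l≡ = ∣+⇒≡ (l k) short l<M (subst (M ∣_) (+-comm (l j) (l k)) M∣) (M∣d k)

      invariant : ∀ m → Invariant (index m)
      invariant zero    = Q-start , M∣d j , D∤d
      invariant (suc m) with invariant m
      ... | inv@(Qk , M∣ , D∤) = Q-next k Qk M∣ long M∣′ , M∣′ ,
        -- As D divides d_k and d_{k+1}, dividing l_j + l_{k+2} would force it to divide l_j + l_k.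
        λ D∣ → D∤ (∣-exchange {y = l j} (Q⇒D∣d k Qk M∣) (long⇒D∣d (suc k) long) D∣)
        where
        k = index m
        long = next-long k inv
        M∣′ : M ∣ l j + l (2 + k)
        M∣′ = ∣-exchange {y = l j} (subst (M ∣_) (+-comm (l (suc k)) (l (2 + k))) (M∣d (suc k)))
          (subst (M ∣_) (+-comm (l k) (l (suc k))) (M∣d k)) M∣

      contradiction : ⊥
      -- `suc (index N-1)` computes to `suc N-1 * 2 + j`, one full period after j.
      contradiction = <⇒≱ short (subst (M ≤_) (period j) (next-long (index N-1) (invariant N-1)))

    -- The window of h_j misses the residue H (mod M), so the following h_{j+1} meets it at an offset
    -- s < M − l_j.  As every l_k ≥ M − l_j, the invariant p_k ≡ p_j + l_j makes each h_k meet it too.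
    tiny⇒D∣d : ∀ j → l j ≤ H → D ∣ d j
    tiny⇒D∣d j l≤H with D ∣? d j
    ... | yes D∣d = D∣d
    ... | no  D∤d with reach M (p j) H
    ...   | t , t<M , p+t≡ with <-≤-connex t (l j)
    ...     | inj₁ t<l = mod⇒∣ (p j) (d j) (window-refine c (repeat j) (∣⇒mod (p j) (M∣d j)) t t<l p+t≡)
    ...     | inj₂ l≤t with m≤n⇒∃[o]m+o≡n l≤t
    ...       | s , refl = ⊥-elim contradiction
      where
      start : ℕ
      start = p j + l j

      H≤ : ∀ k → M ∣ l j + l k → H ≤ l k
      H≤ k M∣ = +-cancelˡ-≤ H _ _ (≤-trans (≤-reflexive (cong (H +_) (sym (+-identityʳ H))))
        (≤-trans (M≤sum (l j) k M∣) (+-monoˡ-≤ (l k) l≤H)))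

      follow : ∀ k → H ≤ l (suc k) → p (suc k) ≡ p k + l k [mod M ]
      follow k H≤l = window-mod c H≤l (meet k)

      Q⇒D∣d : ∀ k → p k ≡ start [mod M ] → M ∣ l j + l k → D ∣ d k
      Q⇒D∣d k pk≡ M∣ = mod⇒∣ (p k) (d k) (window-refine c (repeat k) (∣⇒mod (p k) (M∣d k)) s
        (+-cancelˡ-< (l j) _ _ (<-≤-trans t<M (M≤sum (l j) k M∣)))
        (mod-trans (mod-+ʳ s pk≡) (subst (_≡ H [mod M ]) (sym (+-assoc (p j) (l j) s)) p+t≡)))

      -- Modulo M, p_{k+2} ≡ p_{k+1} + l_{k+1} ≡ p_k + l_k + l_{k+1} = p_k + d_k ≡ p_k. Both uses of
      -- `follow` are allowed, as l_{k+1} ≥ M and l_{k+2} ≥ H.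
      Q-next : ∀ k → p k ≡ start [mod M ] → M ∣ l j + l k → M ≤ l (suc k) → M ∣ l j + l (2 + k) →
        p (2 + k) ≡ start [mod M ]
      Q-next k pk≡ M∣ M≤l M∣′ = mod-trans (follow (suc k) (H≤ (2 + k) M∣′))
        (mod-trans (mod-+ʳ (l (suc k)) (follow k (≤-trans (m≤m+n H _) M≤l)))
        (mod-trans (mod-reflexive (+-assoc (p k) (l k) (l (suc k))))
        (mod-trans (mod-sym (∣⇒mod (p k) (M∣d k))) pk≡)))

      open Loop j (≤-<-trans (m≤m+n (l j) s) t<M) D∤d (λ k → p k ≡ start [mod M ])
        (follow j (H≤ (suc j) (M∣d j))) Q⇒D∣d Q-next

    -- What remains besides tiny and long windows is H < l_j < M. There the loop runs on lengths
    -- alone: H < l_k < M would give M < l_j + l_k < 2M, so each h_k it visits is tiny or long.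
    D∣d : ∀ j → D ∣ d j
    D∣d j with <-≤-connex H (l j) | <-≤-connex (l j) M | D ∣? d j
    ... | inj₂ l≤H | _        | _       = tiny⇒D∣d j l≤H
    ... | inj₁ _   | inj₂ M≤l | _       = long⇒D∣d j M≤l
    ... | inj₁ _   | inj₁ _   | yes D∣d = D∣d
    ... | inj₁ H<l | inj₁ l<M | no D∤d  = ⊥-elim contradiction
      where
      Q⇒D∣d : ∀ k → ⊤ → M ∣ l j + l k → D ∣ d k
      Q⇒D∣d k _ M∣ with <-≤-connex H (l k) | <-≤-connex (l k) M
      ... | inj₂ l≤H  | _          = tiny⇒D∣d k l≤H
      ... | inj₁ _    | inj₂ M≤l   = long⇒D∣d k M≤l
      ... | inj₁ H<lk | inj₁ lk<M  = ⊥-elim (no-multiple M∣)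
        where
        M<sum : M < l j + l k
        M<sum = subst (_< l j + l k) (cong (H +_) (sym (+-identityʳ H))) (+-mono-< H<l H<lk)
        sum<2M : l j + l k < M + M
        sum<2M = +-mono-< l<M lk<M
        no-multiple : ¬ M ∣ l j + l k
        no-multiple M∣ with m≤n⇒∃[o]m+o≡n (<⇒≤ M<sum)
        ... | zero  , eq = <⇒≢ M<sum (trans (sym (+-identityʳ M)) eq)
        ... | suc o , eq = <⇒≱ (+-cancelˡ-< M _ _ (subst (_< M + M) (sym eq) sum<2M))
          (∣⇒≤ (∣m+n∣m⇒∣n (subst (M ∣_) (sym eq) M∣) (divides 1 (sym (+-identityʳ M)))))

      open Loop j l<M D∤d (λ _ → ⊤) tt Q⇒D∣d (λ _ _ _ _ _ → tt)

  2^∣d : ∀ a j → 2 ^ a ∣ d j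
  2^∣d zero          j = 1∣ _
  -- A single letter fixes the parity. The induction starts from exponent 1 because `Step` works
  -- with half of M.
  2^∣d (suc zero)    j = mod⇒∣ (p j) (d j) (window-mod 0 (l>0 j) (repeat j))
  2^∣d (suc (suc c)) j = Step.D∣d c (2^∣d (suc c)) j

  absurd : ⊥
  -- The exponent `d 0` is large enough, since 0 < d 0 < 2^(d 0).
  absurd = <⇒≱ (n<2^n (d 0)) (∣⇒≤ {{>-nonZero (<-≤-trans (l>0 0) (m≤m+n _ _))}} (2^∣d (d 0) 0))

-- Occurrences of T

occursAt-++ : ∀ {A : Set} (u v : List A) {w p} →
  OccursAt (u ++ v) w p → OccursAt u w p × OccursAt v w (p + length u)
occursAt-++ []      v {w} {p} occ = tt , subst (OccursAt v w) (sym (+-identityʳ p)) occ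
occursAt-++ (x ∷ u) v {w} {p} (eq , occ) with occursAt-++ u v occ
... | occᵤ , occᵥ = (eq , occᵤ) , subst (OccursAt v w) (sym (+-suc p (length u))) occᵥ

occursAt⇒same : ∀ u {p q} → OccursAt u b4 p → OccursAt u b4 q → SameWindow p q (length u)
occursAt⇒same (x ∷ u) {p} {q} (eq , _) (eq′ , _) zero _ =
  subst₂ (λ m n → b4 m ≡ b4 n) (sym (+-identityʳ p)) (sym (+-identityʳ q)) (trans eq (sym eq′))
occursAt⇒same (x ∷ u) {p} {q} (_ , occ) (_ , occ′) (suc t) (s≤s t<u) =
  subst₂ (λ m n → b4 m ≡ b4 n) (sym (+-suc p t)) (sym (+-suc q t)) (occursAt⇒same u occ occ′ t t<u)

toℕ-cnext : ∀ {n} (j : Fin (suc n)) → toℕ (cnext j) ≡ suc (toℕ j) % suc n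
toℕ-cnext {n} j with suc (toℕ j) <? suc n
... | yes lt = trans (toℕ-fromℕ< lt) (sym (m<n⇒m%n≡m lt))
... | no  ≮  = sym (trans (cong (_% suc n) (≤-antisym (toℕ<n j) (≮⇒≥ ≮))) (n%n≡0 (suc n)))

-- Iterating `cnext` makes the middle variable of the fragment for `cycle k` definitionally
-- `cycle (suc k)`.
cycle : ∀ {n} → ℕ → Fin (suc n)
cycle zero    = zero
cycle (suc k) = cnext (cycle k)

toℕ-cycle : ∀ {n} k → toℕ (cycle {n} k) ≡ k % suc n
toℕ-cycle {n} zero    = refl
toℕ-cycle {n} (suc k) = begin
  toℕ (cnext (cycle {n} k))     ≡⟨ toℕ-cnext (cycle k) ⟩
  suc (toℕ (cycle {n} k)) % N   ≡⟨ cong (λ m → suc m % N) (toℕ-cycle {n} k) ⟩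
  (1 + k % N) % N               ≡⟨ mod⇒%≡ {N} (mod-suc {k % N} {k} (%≡⇒mod (m%n%n≡m%n k N))) ⟩
  suc k % N                     ∎
  where
  open ≡-Reasoning
  N = suc n
  mod-suc : ∀ {a b} → a ≡ b [mod N ] → suc a ≡ suc b [mod N ]
  mod-suc (r , s , eq) = r , s , cong suc eq

cycle-periodic : ∀ {n} j → cycle {n} (suc n * 2 + j) ≡ cycle j
cycle-periodic {n} j = toℕ-injective (begin
  toℕ (cycle {n} (suc n * 2 + j))   ≡⟨ toℕ-cycle {n} (suc n * 2 + j) ⟩
  (suc n * 2 + j) % suc n           ≡⟨ cong (_% suc n) (trans (+-comm (suc n * 2) j) (cong (j +_) (*-comm (suc n) 2))) ⟩
  (j + 2 * suc n) % suc n           ≡⟨ [m+kn]%n≡m%n j 2 (suc n) ⟩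
  j % suc n                         ≡⟨ toℕ-cycle {n} j ⟨
  toℕ (cycle {n} j)                 ∎)
  where open ≡-Reasoning

theorem13 : (i : ℕ) → 1 ≤ i → Avoids b4 (T i)
theorem13 (suc n) _ (h , occurs) = Cyclic.absurd l p n (λ _ → s≤s z≤n)
  (λ j → cong (length ∘ word) (cycle-periodic j)) repeat meet
  where
  word : Fin (suc n) → List Letter
  word v = toList (h v)

  l p : ℕ → ℕ
  factor : ∀ k → Factor (image h (cycle k ∷ (cnext (cycle k) ∷ cycle k ∷ []))) b4
  l k = length (word (cycle k))
  factor k = occurs _ (∈-map⁺ _ (∈-allFin (cycle k)))
  p k = proj₁ (factor k)

  occ₁ : ∀ k → OccursAt (word (cycle k)) b4 (p k)
  occ₁ k = proj₁ (occursAt-++ (word (cycle k)) _ (proj₂ (factor k)))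

  tail : ∀ k → OccursAt (word (cycle (suc k)) ++ (word (cycle k) ++ [])) b4 (p k + l k)
  tail k = proj₂ (occursAt-++ (word (cycle k)) _ (proj₂ (factor k)))

  occ₂ : ∀ k → OccursAt (word (cycle (suc k))) b4 (p k + l k)
  occ₂ k = proj₁ (occursAt-++ (word (cycle (suc k))) _ (tail k))

  occ₃ : ∀ k → OccursAt (word (cycle k)) b4 (p k + (l k + l (suc k)))
  -- `concatMap` leaves an empty list after the last block, and the two offsets arrive associated to
  -- the left.
  occ₃ k = subst₂ (λ u q → OccursAt u b4 q) (++-identityʳ (word (cycle k))) (+-assoc (p k) (l k) (l (suc k)))
    (proj₂ (occursAt-++ (word (cycle (suc k))) _ (tail k)))

  repeat : ∀ k → SameWindow (p k) (p k + (l k + l (suc k))) (l k)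
  repeat k = occursAt⇒same (word (cycle k)) (occ₁ k) (occ₃ k)

  meet : ∀ k → SameWindow (p (suc k)) (p k + l k) (l (suc k))
  meet k = occursAt⇒same (word (cycle (suc k))) (occ₁ (suc k)) (occ₂ k)
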